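{- A perfect Euler cuboid exists if and only if there exist rational numbers $a,b,u$ with $0<u<1$ and $(a,b)\in D_{ab}$ such that $P(a,b,u)=0$.
   Context: An Euler cuboid is a rectangular parallelepiped whose three edge lengths and three face diagonal lengths are all positive integers; a perfect Euler cuboid is an Euler cuboid whose space diagonal also has integer length, i.e. a $7$-tuple of positive integers $(a,b,c,\alpha,\beta,\gamma,d)$ with $a^2+b^2=\gamma^2$, $b^2+c^2=\alpha^2$, $c^2+a^2=\beta^2$, $a^2+b^2+c^2=d^2$. Let $D_{uz}=\{(u,z)\in\mathbb{R}^2: 0<u<1,\ 0<z<1\}$. Define $f\colon D_{uz}\to\mathbb{R}^2$ by $f(u,z)=(a(u,z),b(u,z))$, where $a(u,z)$ and $b(u,z)$ are the positive real numbers determined by $$a^2=\frac{u^2+z^2}{u^2z^2+1},\qquad b^2=\frac{(1+u^2)(1+z^2)-2z(1-u^2)}{(1+u^2)(1+z^2)+2z(1-u^2)}$$ (both right-hand sides are positive on $D_{uz}$), and let $D_{ab}=f(D_{uz})$. The characteristic polynomial is $$\begin{aligned}P(a,b,u)={}&u^4a^4b^4+6a^4u^2b^4-2u^4a^4b^2-2u^4a^2b^4+4u^2b^4a^2+4a^4u^2b^2-12u^4a^2b^2\\&+u^4a^4+u^4b^4+a^4b^4+6a^4u^2+6u^2b^4-8a^2b^2u^2-2u^4a^2-2u^4b^2-2a^4b^2-2b^4a^2\\&+u^4+b^4+a^4+4a^2u^2+4b^2u^2-12b^2a^2+6u^2-2a^2-2b^2+1.\end{aligned}$$ -}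

module Defs where

open import Data.Integer.Base using (+_; +<+)
open import Data.Nat as ℕ using (ℕ)
import Data.Nat.Properties as ℕ
open import Data.Product using (Σ-syntax; ∃-syntax; _×_; _,_)
open import Data.Rational as ℚ using (ℚ; 0ℚ; 1ℚ)
import Data.Rational.Properties as ℚ
open import Data.Rational.Solver using (module +-*-Solver)
open import Data.Sum using (_⊎_; inj₁; inj₂)
open import Level using (0ℓ)
open import Relation.Binary.PropositionalEquality
  using (_≡_; refl; sym; trans; cong; cong₂; subst; subst₂)
open import Relation.Nullary using (yes; no; contradiction)
open import Relation.Unary using (Pred; _∈_)

record PerfectEulerCuboid : Set where
  field
    a b c α β γ d : ℕ
    a>0 : 0 ℕ.< a
    b>0 : 0 ℕ.< b
    c>0 : 0 ℕ.< c
    α>0 : 0 ℕ.< α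
    β>0 : 0 ℕ.< β
    γ>0 : 0 ℕ.< γ
    d>0 : 0 ℕ.< d
    face-γ : a ℕ.^ 2 ℕ.+ b ℕ.^ 2 ≡ γ ℕ.^ 2
    face-α : b ℕ.^ 2 ℕ.+ c ℕ.^ 2 ≡ α ℕ.^ 2
    face-β : c ℕ.^ 2 ℕ.+ a ℕ.^ 2 ≡ β ℕ.^ 2
    space  : a ℕ.^ 2 ℕ.+ b ℕ.^ 2 ℕ.+ c ℕ.^ 2 ≡ d ℕ.^ 2

2ℚ 4ℚ 6ℚ 8ℚ 12ℚ : ℚ
2ℚ  = + 2 ℚ./ 1
4ℚ  = + 4 ℚ./ 1
6ℚ  = + 6 ℚ./ 1
8ℚ  = + 8 ℚ./ 1
12ℚ = + 12 ℚ./ 1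

module _ where
  open import Data.Rational using (_+_; _*_; _-_)
  open import Algebra.Definitions.RawSemiring ℚ.+-*-rawSemiring using (_^_)

  P : ℚ → ℚ → ℚ → ℚ
  P a b u =
      u ^ 4 * a ^ 4 * b ^ 4 + 6ℚ * a ^ 4 * u ^ 2 * b ^ 4
    - 2ℚ * u ^ 4 * a ^ 4 * b ^ 2 - 2ℚ * u ^ 4 * a ^ 2 * b ^ 4
    + 4ℚ * u ^ 2 * b ^ 4 * a ^ 2 + 4ℚ * a ^ 4 * u ^ 2 * b ^ 2
    - 12ℚ * u ^ 4 * a ^ 2 * b ^ 2 + u ^ 4 * a ^ 4 + u ^ 4 * b ^ 4
    + a ^ 4 * b ^ 4 + 6ℚ * a ^ 4 * u ^ 2 + 6ℚ * u ^ 2 * b ^ 4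
    - 8ℚ * a ^ 2 * b ^ 2 * u ^ 2 - 2ℚ * u ^ 4 * a ^ 2 - 2ℚ * u ^ 4 * b ^ 2
    - 2ℚ * a ^ 4 * b ^ 2 - 2ℚ * b ^ 4 * a ^ 2 + u ^ 4 + b ^ 4 + a ^ 4
    + 4ℚ * a ^ 2 * u ^ 2 + 4ℚ * b ^ 2 * u ^ 2 - 12ℚ * b ^ 2 * a ^ 2
    + 6ℚ * u ^ 2 - 2ℚ * a ^ 2 - 2ℚ * b ^ 2 + 1ℚ

------------------------------------------------------------------------
-- Real numbers: Cauchy sequences of rationals with a modulus, compared
-- by the setoid equality _≈_.

Eventually : Pred ℕ 0ℓ → Set
Eventually P = ∃[ N ] ∀ n → N ℕ.≤ n → P n

IsCauchy : (ℕ → ℚ) → Set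
IsCauchy s = ∀ ε → 0ℚ ℚ.< ε →
  ∃[ N ] ∀ m n → N ℕ.≤ m → N ℕ.≤ n → ℚ.∣ s m ℚ.- s n ∣ ℚ.< ε

-- Total reciprocal, with recip 0 = 0 as an unused default.
recip : ℚ → ℚ
recip q with q ℚ.≟ 0ℚ
... | yes _   = 0ℚ
... | no  q≢0 = ℚ.1/_ q {{ℚ.≢-nonZero q≢0}}

private
  open +-*-Solver

abstract

  add-back : ∀ p q → q ℚ.+ (p ℚ.- q) ≡ p
  add-back = solve 2 (λ p q → q :+ (p :- q) := p) refl

  +-diff : ∀ a b c d → (a ℚ.- b) ℚ.+ (c ℚ.- d) ≡ (a ℚ.+ c) ℚ.- (b ℚ.+ d)
  +-diff = solve 4 (λ a b c d →
    (a :- b) :+ (c :- d) := (a :+ c) :- (b :+ d)) refl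

  neg-diff : ∀ a b → ℚ.- (a ℚ.- b) ≡ (ℚ.- a) ℚ.- (ℚ.- b)
  neg-diff = solve 2 (λ a b → :- (a :- b) := (:- a) :- (:- b)) refl

  recip-diff : ∀ p q i j →
    (i ℚ.* j) ℚ.* (q ℚ.- p) ≡ i ℚ.* (q ℚ.* j) ℚ.- j ℚ.* (p ℚ.* i)
  recip-diff = solve 4 (λ p q i j →
    (i :* j) :* (q :- p) := i :* (q :* j) :- j :* (p :* i)) refl

  neg-sq : ∀ q → (ℚ.- q) ℚ.* (ℚ.- q) ≡ q ℚ.* q
  neg-sq = solve 1 (λ q → (:- q) :* (:- q) := q :* q) refl

  expand : ∀ u z →
    ((u ℚ.* u ℚ.+ (z ℚ.* z ℚ.+ (u ℚ.* u) ℚ.* (z ℚ.* z)))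
      ℚ.+ (z ℚ.+ z) ℚ.* ((1ℚ ℚ.- u) ℚ.* (1ℚ ℚ.+ u))) ℚ.+ 1ℚ
    ≡ (1ℚ ℚ.+ u ℚ.* u) ℚ.* (1ℚ ℚ.+ z ℚ.* z)
      ℚ.+ 2ℚ ℚ.* z ℚ.* (1ℚ ℚ.- u ℚ.* u)
  expand = solve 2 (λ u z → let 1′ = con 1ℚ in
    ((u :* u :+ (z :* z :+ (u :* u) :* (z :* z)))
      :+ (z :+ z) :* ((1′ :- u) :* (1′ :+ u))) :+ 1′
    := (1′ :+ u :* u) :* (1′ :+ z :* z)
      :+ con 2ℚ :* z :* (1′ :- u :* u)) refl

  *-diff : ∀ a b c d →
    a ℚ.* (c ℚ.- d) ℚ.+ d ℚ.* (a ℚ.- b) ≡ a ℚ.* c ℚ.- b ℚ.* d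
  *-diff = solve 4 (λ a b c d →
    a :* (c :- d) :+ d :* (a :- b) := a :* c :- b :* d) refl

  ½ε : ℚ → ℚ
  ½ε ε = ℚ.½ ℚ.* ε

  ½ε>0 : ∀ {ε} → 0ℚ ℚ.< ε → 0ℚ ℚ.< ½ε ε
  ½ε>0 {ε} 0<ε =
    subst (ℚ._< ½ε ε) (ℚ.*-zeroʳ ℚ.½) (ℚ.*-monoʳ-<-pos ℚ.½ 0<ε)

  ½ε+½ε : ∀ ε → ½ε ε ℚ.+ ½ε ε ≡ ε
  ½ε+½ε ε = trans (sym (ℚ.*-distribʳ-+ ε ℚ.½ ℚ.½)) (ℚ.*-identityˡ ε)

  pos* : ∀ {p q} → 0ℚ ℚ.< p → 0ℚ ℚ.< q → 0ℚ ℚ.< p ℚ.* q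
  pos* {p} {q} 0<p 0<q =
    subst (ℚ._< p ℚ.* q) (ℚ.*-zeroʳ p)
      (ℚ.*-monoʳ-<-pos p {{ℚ.positive 0<p}} 0<q)

  *-bound : ∀ {p q r s} → 0ℚ ℚ.≤ q → p ℚ.≤ r → 0ℚ ℚ.< r → q ℚ.< s →
            p ℚ.* q ℚ.< r ℚ.* s
  *-bound {p} {q} {r} {s} 0≤q p≤r 0<r q<s = ℚ.≤-<-trans
    (ℚ.*-monoʳ-≤-nonNeg q {{ℚ.nonNegative 0≤q}} p≤r)
    (ℚ.*-monoʳ-<-pos r {{ℚ.positive 0<r}} q<s)

  -- |p| < |q| + 1 whenever |p - q| < 1
  near : ∀ p q → ℚ.∣ p ℚ.- q ∣ ℚ.< 1ℚ → ℚ.∣ p ∣ ℚ.< ℚ.∣ q ∣ ℚ.+ 1ℚ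
  near p q h = ℚ.≤-<-trans
    (subst (λ t → ℚ.∣ t ∣ ℚ.≤ ℚ.∣ q ∣ ℚ.+ ℚ.∣ p ℚ.- q ∣)
      (add-back p q)
      (ℚ.∣p+q∣≤∣p∣+∣q∣ q (p ℚ.- q)))
    (ℚ.+-monoʳ-< ℚ.∣ q ∣ h)

  const-cauchy : ∀ q → IsCauchy (λ _ → q)
  const-cauchy q ε 0<ε = 0 , λ _ _ _ _ →
    subst (λ t → ℚ.∣ t ∣ ℚ.< ε) (sym (ℚ.+-inverseʳ q)) 0<ε

  +-cauchy : ∀ s t → IsCauchy s → IsCauchy t → IsCauchy (λ n → s n ℚ.+ t n)
  +-cauchy s t cs ct ε 0<ε
    with cs (½ε ε) (½ε>0 0<ε) | ct (½ε ε) (½ε>0 0<ε)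
  ... | M , hs | N , ht = M ℕ.⊔ N , λ m n M⊔N≤m M⊔N≤n →
    subst₂ (λ l r → ℚ.∣ l ∣ ℚ.< r)
      (+-diff (s m) (s n) (t m) (t n))
      (½ε+½ε ε)
      (ℚ.≤-<-trans (ℚ.∣p+q∣≤∣p∣+∣q∣ (s m ℚ.- s n) (t m ℚ.- t n))
        (ℚ.+-mono-<
          (hs m n (ℕ.m⊔n≤o⇒m≤o M N M⊔N≤m) (ℕ.m⊔n≤o⇒m≤o M N M⊔N≤n))
          (ht m n (ℕ.m⊔n≤o⇒n≤o M N M⊔N≤m) (ℕ.m⊔n≤o⇒n≤o M N M⊔N≤n))))

  neg-cauchy : ∀ s → IsCauchy s → IsCauchy (λ n → ℚ.- s n)
  neg-cauchy s cs ε 0<ε with cs ε 0<ε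
  ... | N , h = N , λ m n N≤m N≤n →
    subst (ℚ._< ε)
      (trans (sym (ℚ.∣-p∣≡∣p∣ (s m ℚ.- s n)))
        (cong ℚ.∣_∣ (neg-diff (s m) (s n))))
      (h m n N≤m N≤n)

  bounded : ∀ s → IsCauchy s →
            ∃[ B ] 0ℚ ℚ.< B × Eventually (λ n → ℚ.∣ s n ∣ ℚ.≤ B)
  bounded s cs with cs 1ℚ (ℚ.positive⁻¹ 1ℚ)
  ... | N , h =
      ℚ.∣ s N ∣ ℚ.+ 1ℚ
    , ℚ.≤-<-trans (ℚ.0≤∣p∣ (s N))
        (subst (ℚ._< ℚ.∣ s N ∣ ℚ.+ 1ℚ) (ℚ.+-identityʳ ℚ.∣ s N ∣)
          (ℚ.+-monoʳ-< ℚ.∣ s N ∣ (ℚ.positive⁻¹ 1ℚ)))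
    , N , λ n N≤n → ℚ.<⇒≤ (near (s n) (s N) (h n N N≤n ℕ.≤-refl))

  quotient : ∀ D ε → 0ℚ ℚ.< D → 0ℚ ℚ.< ε → ∃[ δ ] 0ℚ ℚ.< δ × D ℚ.* δ ≡ ε
  quotient D ε 0<D 0<ε = D⁻¹ ℚ.* ε , pos* D⁻¹>0 0<ε ,
    trans (sym (ℚ.*-assoc D D⁻¹ ε))
      (trans (cong (ℚ._* ε) (ℚ.*-inverseʳ D {{D≢0}})) (ℚ.*-identityˡ ε))
    where
    D≢0 : ℚ.NonZero D
    D≢0 = ℚ.>-nonZero 0<D
    D⁻¹ : ℚ
    D⁻¹ = ℚ.1/_ D {{D≢0}}
    D⁻¹>0 : 0ℚ ℚ.< D⁻¹
    D⁻¹>0 = ℚ.positive⁻¹ D⁻¹ {{ℚ.1/pos⇒pos D {{ℚ.positive 0<D}}}}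

  ∣*∣< : ∀ p q B δ ε → 0ℚ ℚ.< B → B ℚ.* δ ≡ ε →
         ℚ.∣ p ∣ ℚ.≤ B → ℚ.∣ q ∣ ℚ.< δ → ℚ.∣ p ℚ.* q ∣ ℚ.< ε
  ∣*∣< p q B δ ε 0<B Bδ≡ε p≤B q<δ =
    subst₂ ℚ._<_ (sym (ℚ.∣p*q∣≡∣p∣*∣q∣ p q)) Bδ≡ε
      (*-bound (ℚ.0≤∣p∣ q) p≤B 0<B q<δ)

  ∣+∣< : ∀ p q ε → ℚ.∣ p ∣ ℚ.< ½ε ε → ℚ.∣ q ∣ ℚ.< ½ε ε → ℚ.∣ p ℚ.+ q ∣ ℚ.< ε
  ∣+∣< p q ε p< q< = subst (ℚ.∣ p ℚ.+ q ∣ ℚ.<_) (½ε+½ε ε)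
    (ℚ.≤-<-trans (ℚ.∣p+q∣≤∣p∣+∣q∣ p q) (ℚ.+-mono-< p< q<))

  -- |ac - bd| ≤ |a||c - d| + |d||a - b|
  *-close : ∀ {a b c d B C δ η ε} → 0ℚ ℚ.< B → 0ℚ ℚ.< C →
            C ℚ.* δ ≡ ½ε ε → B ℚ.* η ≡ ½ε ε →
            ℚ.∣ a ∣ ℚ.≤ B → ℚ.∣ d ∣ ℚ.≤ C →
            ℚ.∣ a ℚ.- b ∣ ℚ.< δ → ℚ.∣ c ℚ.- d ∣ ℚ.< η →
            ℚ.∣ a ℚ.* c ℚ.- b ℚ.* d ∣ ℚ.< ε
  *-close {a} {b} {c} {d} {B} {C} {δ} {η} {ε} 0<B 0<C Cδ Bη a≤B d≤C a-b c-d =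
    subst (λ l → ℚ.∣ l ∣ ℚ.< ε) (*-diff a b c d)
      (∣+∣< (a ℚ.* (c ℚ.- d)) (d ℚ.* (a ℚ.- b)) ε
        (∣*∣< a (c ℚ.- d) B η (½ε ε) 0<B Bη a≤B c-d)
        (∣*∣< d (a ℚ.- b) C δ (½ε ε) 0<C Cδ d≤C a-b))

  *-cauchy : ∀ s t → IsCauchy s → IsCauchy t → IsCauchy (λ n → s n ℚ.* t n)
  *-cauchy s t cs ct ε 0<ε =
    let B , 0<B , K , hB = bounded s cs
        C , 0<C , L , hC = bounded t ct
        δ , 0<δ , Cδ = quotient C (½ε ε) 0<C (½ε>0 0<ε)
        η , 0<η , Bη = quotient B (½ε ε) 0<B (½ε>0 0<ε)
        M , hs = cs δ 0<δ
        N , ht = ct η 0<η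
    in (K ℕ.⊔ L) ℕ.⊔ (M ℕ.⊔ N) , λ m n ≤m ≤n →
    let KL≤m = ℕ.m⊔n≤o⇒m≤o (K ℕ.⊔ L) (M ℕ.⊔ N) ≤m
        KL≤n = ℕ.m⊔n≤o⇒m≤o (K ℕ.⊔ L) (M ℕ.⊔ N) ≤n
        MN≤m = ℕ.m⊔n≤o⇒n≤o (K ℕ.⊔ L) (M ℕ.⊔ N) ≤m
        MN≤n = ℕ.m⊔n≤o⇒n≤o (K ℕ.⊔ L) (M ℕ.⊔ N) ≤n
    in *-close {s m} {s n} {t m} {t n} {B} {C} {δ} {η} {ε} 0<B 0<C Cδ Bη
         (hB m (ℕ.m⊔n≤o⇒m≤o K L KL≤m))
         (hC n (ℕ.m⊔n≤o⇒n≤o K L KL≤n))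
         (hs m n (ℕ.m⊔n≤o⇒m≤o M N MN≤m) (ℕ.m⊔n≤o⇒m≤o M N MN≤n))
         (ht m n (ℕ.m⊔n≤o⇒n≤o M N MN≤m) (ℕ.m⊔n≤o⇒n≤o M N MN≤n))

  recip-spec : ∀ q → 0ℚ ℚ.< q → 0ℚ ℚ.< recip q × q ℚ.* recip q ≡ 1ℚ
  recip-spec q 0<q with q ℚ.≟ 0ℚ
  ... | yes q≡0 = contradiction (sym q≡0) (ℚ.<⇒≢ 0<q)
  ... | no  q≢0 =
      ℚ.positive⁻¹ _ {{ℚ.1/pos⇒pos q {{ℚ.positive 0<q}}}}
    , ℚ.*-inverseʳ q {{ℚ.≢-nonZero q≢0}}

  inverse-≤ : ∀ e p E i → 0ℚ ℚ.< E → 0ℚ ℚ.< i → e ℚ.≤ p →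
              e ℚ.* E ≡ 1ℚ → p ℚ.* i ≡ 1ℚ → i ℚ.≤ E
  inverse-≤ e p E i 0<E 0<i e≤p eE≡1 pi≡1 = subst₂ ℚ._≤_
    (trans (sym (ℚ.*-assoc E e i))
      (trans (cong (ℚ._* i) (trans (ℚ.*-comm E e) eE≡1)) (ℚ.*-identityˡ i)))
    (trans (cong (E ℚ.*_) pi≡1) (ℚ.*-identityʳ E))
    (ℚ.*-monoˡ-≤-nonNeg E {{ℚ.nonNegative (ℚ.<⇒≤ 0<E)}}
      (ℚ.*-monoʳ-≤-nonNeg i {{ℚ.nonNegative (ℚ.<⇒≤ 0<i)}} e≤p))

  -- 1/p - 1/q = (1/p)(1/q)(q - p)
  inverse-close : ∀ p q i j E δ ε → 0ℚ ℚ.< E → 0ℚ ℚ.< i → 0ℚ ℚ.< j →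
    i ℚ.≤ E → j ℚ.≤ E → p ℚ.* i ≡ 1ℚ → q ℚ.* j ≡ 1ℚ →
    (E ℚ.* E) ℚ.* δ ≡ ε → ℚ.∣ q ℚ.- p ∣ ℚ.< δ → ℚ.∣ i ℚ.- j ∣ ℚ.< ε
  inverse-close p q i j E δ ε 0<E 0<i 0<j i≤E j≤E pi≡1 qj≡1 EEδ h =
    subst (λ l → ℚ.∣ l ∣ ℚ.< ε)
      (trans (recip-diff p q i j)
        (cong₂ ℚ._-_
          (trans (cong (i ℚ.*_) qj≡1) (ℚ.*-identityʳ i))
          (trans (cong (j ℚ.*_) pi≡1) (ℚ.*-identityʳ j))))
      (∣*∣< (i ℚ.* j) (q ℚ.- p) (E ℚ.* E) δ ε (pos* 0<E 0<E) EEδ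
        (subst (ℚ._≤ E ℚ.* E) (sym (ℚ.0≤p⇒∣p∣≡p (ℚ.<⇒≤ (pos* 0<i 0<j))))
          (ℚ.≤-trans
            (ℚ.*-monoʳ-≤-nonNeg j {{ℚ.nonNegative (ℚ.<⇒≤ 0<j)}} i≤E)
            (ℚ.*-monoˡ-≤-nonNeg E {{ℚ.nonNegative (ℚ.<⇒≤ 0<E)}} j≤E)))
        h)

  recip-cauchy : ∀ s → IsCauchy s →
    ∃[ e ] 0ℚ ℚ.< e × Eventually (λ n → e ℚ.< s n ℚ.- 0ℚ) →
    IsCauchy (λ n → recip (s n))
  recip-cauchy s cs (e , 0<e , K , hK) ε 0<ε =
    let E , 0<E , eE = quotient e 1ℚ 0<e (ℚ.positive⁻¹ 1ℚ)
        δ , 0<δ , EEδ = quotient (E ℚ.* E) ε (pos* 0<E 0<E) 0<ε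
        N , h = cs δ 0<δ
        e≤s : ∀ n → K ℕ.≤ n → e ℚ.≤ s n
        e≤s n K≤n = subst (e ℚ.≤_) (ℚ.+-identityʳ (s n)) (ℚ.<⇒≤ (hK n K≤n))
    in K ℕ.⊔ N , λ m n ≤m ≤n →
    let K≤m = ℕ.m⊔n≤o⇒m≤o K N ≤m
        K≤n = ℕ.m⊔n≤o⇒m≤o K N ≤n
        0<i , pi = recip-spec (s m) (ℚ.<-≤-trans 0<e (e≤s m K≤m))
        0<j , qj = recip-spec (s n) (ℚ.<-≤-trans 0<e (e≤s n K≤n))
    in inverse-close (s m) (s n) (recip (s m)) (recip (s n)) E δ ε 0<E 0<i 0<j
         (inverse-≤ e (s m) E (recip (s m)) 0<E 0<i (e≤s m K≤m) eE pi)
         (inverse-≤ e (s n) E (recip (s n)) 0<E 0<j (e≤s n K≤n) eE qj)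
         pi qj EEδ
         (h n m (ℕ.m⊔n≤o⇒n≤o K N ≤n) (ℕ.m⊔n≤o⇒n≤o K N ≤m))

record ℝ : Set where
  constructor mkℝ
  field
    seq    : ℕ → ℚ
    cauchy : IsCauchy seq

open ℝ public

infix  4 _≈_ _<_
infixl 6 _+_ _-_
infixl 7 _*_ _/_⟨_⟩
infix  8 -_
infix  9 _²

_≈_ : ℝ → ℝ → Set
x ≈ y = ∀ ε → 0ℚ ℚ.< ε → Eventually λ n → ℚ.∣ seq x n ℚ.- seq y n ∣ ℚ.< ε

_<_ : ℝ → ℝ → Set
x < y = ∃[ ε ] 0ℚ ℚ.< ε × Eventually λ n → ε ℚ.< seq y n ℚ.- seq x n

fromℚ : ℚ → ℝ
fromℚ q = mkℝ (λ _ → q) (const-cauchy q)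

0ℝ 1ℝ 2ℝ : ℝ
0ℝ = fromℚ 0ℚ
1ℝ = fromℚ 1ℚ
2ℝ = fromℚ 2ℚ

_+_ : ℝ → ℝ → ℝ
x + y = mkℝ (λ n → seq x n ℚ.+ seq y n)
            (+-cauchy (seq x) (seq y) (cauchy x) (cauchy y))

-_ : ℝ → ℝ
- x = mkℝ (λ n → ℚ.- seq x n) (neg-cauchy (seq x) (cauchy x))

_-_ : ℝ → ℝ → ℝ
x - y = x + (- y)

_*_ : ℝ → ℝ → ℝ
x * y = mkℝ (λ n → seq x n ℚ.* seq y n)
            (*-cauchy (seq x) (seq y) (cauchy x) (cauchy y))

_² : ℝ → ℝ
x ² = x * x

-- The proof of positivity does not affect the underlying sequence.
_/_⟨_⟩ : (x y : ℝ) → 0ℝ < y → ℝ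
x / y ⟨ 0<y ⟩ =
  x * mkℝ (λ n → recip (seq y n)) (recip-cauchy (seq y) (cauchy y) 0<y)

abstract
  0<1+ : ∀ q → 0ℚ ℚ.≤ q → ℚ.½ ℚ.< q ℚ.+ 1ℚ ℚ.- 0ℚ
  0<1+ q 0≤q = subst (ℚ.½ ℚ.<_) (sym (ℚ.+-identityʳ (q ℚ.+ 1ℚ)))
    (ℚ.<-≤-trans (ℚ.*<* (+<+ (ℕ.s≤s (ℕ.s≤s ℕ.z≤n))))
      (subst (ℚ._≤ q ℚ.+ 1ℚ) (ℚ.+-identityˡ 1ℚ) (ℚ.+-monoˡ-≤ 1ℚ 0≤q)))

  sq≥0 : ∀ q → 0ℚ ℚ.≤ q ℚ.* q
  sq≥0 q = subst (0ℚ ℚ.≤_) (∣q∣²≡q² (ℚ.∣p∣≡p∨∣p∣≡-p q))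
      (subst (ℚ._≤ ℚ.∣ q ∣ ℚ.* ℚ.∣ q ∣) (ℚ.*-zeroʳ ℚ.∣ q ∣)
        (ℚ.*-monoˡ-≤-nonNeg ℚ.∣ q ∣ {{ℚ.∣-∣-nonNeg q}} (ℚ.0≤∣p∣ q)))
    where
    ∣q∣²≡q² : ℚ.∣ q ∣ ≡ q ⊎ ℚ.∣ q ∣ ≡ ℚ.- q → ℚ.∣ q ∣ ℚ.* ℚ.∣ q ∣ ≡ q ℚ.* q
    ∣q∣²≡q² (inj₁ e) = cong₂ ℚ._*_ e e
    ∣q∣²≡q² (inj₂ e) = trans (cong₂ ℚ._*_ e e) (neg-sq q)

  nonNeg* : ∀ {p q} → 0ℚ ℚ.≤ p → 0ℚ ℚ.≤ q → 0ℚ ℚ.≤ p ℚ.* q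
  nonNeg* {p} {q} 0≤p 0≤q = subst (ℚ._≤ p ℚ.* q) (ℚ.*-zeroʳ p)
    (ℚ.*-monoˡ-≤-nonNeg p {{ℚ.nonNegative 0≤p}} 0≤q)

  minus0 : ∀ {p} → 0ℚ ℚ.< p ℚ.- 0ℚ → 0ℚ ℚ.≤ p
  minus0 {p} h = subst (0ℚ ℚ.≤_) (ℚ.+-identityʳ p) (ℚ.<⇒≤ h)

  nonNeg+ : ∀ {p q} → 0ℚ ℚ.≤ p → 0ℚ ℚ.≤ q → 0ℚ ℚ.≤ p ℚ.+ q
  nonNeg+ = ℚ.+-mono-≤

  -- (1+u²)(1+z²) + 2z(1-u²) = (u² + z² + u²z²) + 2z(1-u)(1+u) + 1
  den-bound : ∀ u z → 0ℚ ℚ.≤ u → 0ℚ ℚ.≤ 1ℚ ℚ.- u → 0ℚ ℚ.≤ z →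
    ℚ.½ ℚ.< (1ℚ ℚ.+ u ℚ.* u) ℚ.* (1ℚ ℚ.+ z ℚ.* z)
            ℚ.+ 2ℚ ℚ.* z ℚ.* (1ℚ ℚ.- u ℚ.* u) ℚ.- 0ℚ
  den-bound u z 0≤u 0≤1-u 0≤z = subst (λ l → ℚ.½ ℚ.< l ℚ.- 0ℚ)
    (expand u z)
    (0<1+ _ (nonNeg+ (nonNeg+ (sq≥0 u) (nonNeg+ (sq≥0 z) (nonNeg* (sq≥0 u) (sq≥0 z))))
      (nonNeg* (nonNeg+ 0≤z 0≤z)
        (nonNeg* 0≤1-u (nonNeg+ (ℚ.<⇒≤ (ℚ.positive⁻¹ 1ℚ)) 0≤u)))))

D-uz : Pred (ℝ × ℝ) 0ℓ
D-uz (u , z) = (0ℝ < u × u < 1ℝ) × (0ℝ < z × z < 1ℝ)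

a²-num a²-den b²-num b²-den : ℝ → ℝ → ℝ
a²-num u z = u ² + z ²
a²-den u z = u ² * z ² + 1ℝ
b²-num u z = (1ℝ + u ²) * (1ℝ + z ²) - 2ℝ * z * (1ℝ - u ²)
b²-den u z = (1ℝ + u ²) * (1ℝ + z ²) + 2ℝ * z * (1ℝ - u ²)

abstract
  a²-den>0 : ∀ u z → (u , z) ∈ D-uz → 0ℝ < a²-den u z
  a²-den>0 u z _ = ℚ.½ , ℚ.positive⁻¹ ℚ.½ , 0 , λ n _ →
    0<1+ _ (nonNeg* (sq≥0 (seq u n)) (sq≥0 (seq z n)))

  b²-den>0 : ∀ u z → (u , z) ∈ D-uz → 0ℝ < b²-den u z
  b²-den>0 u z (((e , 0<e , K , hK) , (e′ , 0<e′ , L , hL)) , ((e″ , 0<e″ , M , hM) , _)) =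
    ℚ.½ , ℚ.positive⁻¹ ℚ.½ , K ℕ.⊔ (L ℕ.⊔ M) , λ n ≤n →
      den-bound (seq u n) (seq z n)
        (minus0 (ℚ.<-trans 0<e (hK n (ℕ.m⊔n≤o⇒m≤o K (L ℕ.⊔ M) ≤n))))
        (ℚ.<⇒≤ (ℚ.<-trans 0<e′ (hL n (ℕ.m⊔n≤o⇒m≤o L M (ℕ.m⊔n≤o⇒n≤o K (L ℕ.⊔ M) ≤n)))))
        (minus0 (ℚ.<-trans 0<e″ (hM n (ℕ.m⊔n≤o⇒n≤o L M (ℕ.m⊔n≤o⇒n≤o K (L ℕ.⊔ M) ≤n)))))

-- The graph of f : D-uz → ℝ × ℝ, i.e. f (u , z) = (a , b): a and b are the
-- positive square roots of the two quotients.
record HasValue-f (u z : ℝ) (uz∈D : (u , z) ∈ D-uz) (a b : ℝ) : Set where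
  field
    a>0  : 0ℝ < a
    b>0  : 0ℝ < b
    a²≈ : a ² ≈ a²-num u z / a²-den u z ⟨ a²-den>0 u z uz∈D ⟩
    b²≈ : b ² ≈ b²-num u z / b²-den u z ⟨ b²-den>0 u z uz∈D ⟩

D-ab : Pred (ℝ × ℝ) 0ℓ
D-ab (a , b) = ∃[ u ] ∃[ z ] Σ[ uz∈D ∈ (u , z) ∈ D-uz ] HasValue-f u z uz∈D a b

{-# OPTIONS --safe #-}

-- Normalise the space diagonal to 1. A cuboid with edges x, y, w and face
-- diagonal γ over x, y is given by x² + y² = γ² together with the rational
-- points (x , α), (y , β), (γ , w) on the unit circle. Their half-angle tangents
-- a, b, u turn x² + y² = γ² into P a b u = 0, and the point (x/γ , y/γ), with
-- half-angle tangent z, satisfies the equations defining f (u , z) = (a , b).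
-- Conversely, points of D-ab have a, b > 0 and a², b² ≠ 1, so that the edges and
-- diagonals read off from a root of P are non-zero; clearing denominators and
-- signs gives a cuboid.

module Submission where

open import Defs hiding (_+_; _-_; _*_; -_)
import Algebra.Properties.Group as Group
open import Data.Integer.Base as ℤ using (ℤ)
import Data.Integer.Properties as ℤ
open import Data.List.Base using ([]; _∷_)
open import Data.List.Relation.Unary.All as All using (All; []; _∷_)
open import Data.Nat as ℕ using (ℕ)
import Data.Nat.Properties as ℕ
open import Data.Product using (∃-syntax; _×_; _,_)
open import Data.Rational as ℚ using (ℚ; 0ℚ; 1ℚ; _+_; _*_; _-_; -_; ↥_; ↧ₙ_)
import Data.Rational.Literals as Literals
import Data.Rational.Properties as ℚ
open import Data.Rational.Solver using (module +-*-Solver)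
import Data.Rational.Unnormalised as ℚᵘ
import Data.Rational.Unnormalised.Properties as ℚᵘ
open import Function.Bundles using (_⇔_; mk⇔)
open import Relation.Binary.PropositionalEquality
  using (_≡_; _≢_; refl; sym; trans; cong; cong₂; subst; subst₂; module ≡-Reasoning)
open import Relation.Nullary using (¬_)
open import Relation.Unary using (_∈_)

open +-*-Solver
open Group ℚ.+-0-group using (∙-cancelʳ; x∙y⁻¹≈ε⇒x≈y)

-- Rational arithmetic

infix 8 _²ℚ

_²ℚ : ℚ → ℚ
x ²ℚ = x * x

-- Lets the ring solver work modulo a hypothesis `e ≡ f`: the solver proves the unconditional
-- identity `x + e ≡ y + f`, from which the hypothesis is then cancelled.
balance : ∀ {x y e f} → x + e ≡ y + f → e ≡ f → x ≡ y
balance {x} {y} {e} x+e≡y+f refl = ∙-cancelʳ e x y x+e≡y+f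

*-cancelˡ-pos : ∀ {r p q} → 0ℚ ℚ.< r → r * p ≡ r * q → p ≡ q
*-cancelˡ-pos {r} 0<r eq = ℚ.≤-antisym
  (ℚ.*-cancelˡ-≤-pos r {{ℚ.positive 0<r}} (ℚ.≤-reflexive eq))
  (ℚ.*-cancelˡ-≤-pos r {{ℚ.positive 0<r}} (ℚ.≤-reflexive (sym eq)))

*-cancelʳ-0<-pos : ∀ {p r} → 0ℚ ℚ.< r → 0ℚ ℚ.< p * r → 0ℚ ℚ.< p
*-cancelʳ-0<-pos {p} {r} 0<r 0<pr =
  ℚ.*-cancelʳ-<-nonNeg r {{ℚ.nonNegative (ℚ.<⇒≤ 0<r)}}
    (subst (ℚ._< p * r) (sym (ℚ.*-zeroˡ r)) 0<pr)

*-nonZero : ∀ {p q} → p ≢ 0ℚ → q ≢ 0ℚ → p * q ≢ 0ℚ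
*-nonZero {p} {q} p≢0 q≢0 pq≡0 = p≢0 (begin
  p                  ≡⟨ sym (ℚ.*-identityʳ p) ⟩
  p * 1ℚ             ≡⟨ cong (p *_) (sym (ℚ.*-inverseʳ q)) ⟩
  p * (q * ℚ.1/ q)   ≡⟨ sym (ℚ.*-assoc p q (ℚ.1/ q)) ⟩
  p * q * ℚ.1/ q     ≡⟨ cong (_* ℚ.1/ q) pq≡0 ⟩
  0ℚ * ℚ.1/ q        ≡⟨ ℚ.*-zeroˡ (ℚ.1/ q) ⟩
  0ℚ                 ∎)
  where
  open ≡-Reasoning
  instance
    q-nonZero : ℚ.NonZero q
    q-nonZero = ℚ.≢-nonZero q≢0

0<1 : 0ℚ ℚ.< 1ℚ
0<1 = ℚ.positive⁻¹ 1ℚ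

1<1+ : ∀ {q} → 0ℚ ℚ.< q → 1ℚ ℚ.< 1ℚ + q
1<1+ = ℚ.+-monoʳ-< 1ℚ

>⇒≢0 : ∀ {q} → 0ℚ ℚ.< q → q ≢ 0ℚ
>⇒≢0 0<q q≡0 = ℚ.<⇒≢ 0<q (sym q≡0)

0<+ : ∀ {p q} → 0ℚ ℚ.< p → 0ℚ ℚ.< q → 0ℚ ℚ.< p + q
0<+ = ℚ.+-mono-<

0<1+sq : ∀ q → 0ℚ ℚ.< 1ℚ + q ²ℚ
0<1+sq q = ℚ.+-mono-<-≤ 0<1 (sq≥0 q)

p<q⇒0<q-p : ∀ {p q} → p ℚ.< q → 0ℚ ℚ.< q - p
p<q⇒0<q-p {p} {q} p<q =
  subst (ℚ._< q - p) (ℚ.+-inverseʳ p) (ℚ.+-monoˡ-< (- p) p<q)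

0<q-p⇒p<q : ∀ {p q} → 0ℚ ℚ.< q - p → p ℚ.< q
0<q-p⇒p<q {p} {q} 0<q-p =
  subst₂ ℚ._<_ (ℚ.+-identityʳ p) (add-back q p) (ℚ.+-monoʳ-< p 0<q-p)

*-mono-<-pos : ∀ {e p f q} → 0ℚ ℚ.< e → e ℚ.< p → 0ℚ ℚ.< f → f ℚ.< q → e * f ℚ.< p * q
*-mono-<-pos 0<e e<p 0<f f<q =
  *-bound (ℚ.<⇒≤ 0<f) (ℚ.<⇒≤ e<p) (ℚ.<-trans 0<e e<p) f<q

-- Clearing denominators

-- Kept abstract because products of concrete fractions would otherwise unfold
-- to gcd normalisations.
abstract
  fromℤ : ℤ → ℚ
  fromℤ = Literals.fromℤ

  fromℤ-* : ∀ i j → fromℤ (i ℤ.* j) ≡ fromℤ i * fromℤ j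
  fromℤ-* i j = ℚ.toℚᵘ-injective
    (ℚᵘ.≃-sym (ℚ.toℚᵘ-homo-* (fromℤ i) (fromℤ j)))

  fromℤ-+ : ∀ i j → fromℤ (i ℤ.+ j) ≡ fromℤ i + fromℤ j
  fromℤ-+ i j = ℚ.toℚᵘ-injective (ℚᵘ.≃-trans
    (ℚᵘ.*≡* (cong (ℤ._* ℤ.1ℤ) (sym (cong₂ ℤ._+_ (ℤ.*-identityʳ i) (ℤ.*-identityʳ j)))))
    (ℚᵘ.≃-sym (ℚ.toℚᵘ-homo-+ (fromℤ i) (fromℤ j))))

  fromℤ-0 : fromℤ ℤ.0ℤ ≡ 0ℚ
  fromℤ-0 = refl

  fromℤ-injective : ∀ {i j} → fromℤ i ≡ fromℤ j → i ≡ j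
  fromℤ-injective = cong ↥_

  fromℤ>0 : ∀ {n} → 0 ℕ.< n → 0ℚ ℚ.< fromℤ (ℤ.+ n)
  fromℤ>0 {ℕ.suc n} _ = ℚ.positive⁻¹ (fromℤ (ℤ.+ ℕ.suc n))

  denominator*p : ∀ p → fromℤ (ℤ.+ ↧ₙ p) * p ≡ fromℤ (↥ p)
  denominator*p p@record{} = ℚ.toℚᵘ-injective (ℚᵘ.≃-trans
    (ℚ.toℚᵘ-homo-* (fromℤ (ℤ.+ ↧ₙ p)) p)
    (ℚᵘ.*≡* (trans (ℤ.*-identityʳ _) (trans (ℤ.*-comm (ℤ.+ ↧ₙ p) (↥ p))
      (cong (λ k → ↥ p ℤ.* ℤ.+ k) (sym (ℕ.*-identityˡ (↧ₙ p))))))))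

fromℕ : ℕ → ℚ
fromℕ n = fromℤ (ℤ.+ n)

fromℕ-sq : ∀ n → fromℕ (n ℕ.^ 2) ≡ fromℕ n ²ℚ
fromℕ-sq n = trans
  (cong fromℤ (trans (cong (λ k → ℤ.+ (n ℕ.* k)) (ℕ.*-identityʳ n)) (ℤ.pos-* n n)))
  (fromℤ-* (ℤ.+ n) (ℤ.+ n))

fromℤ-sq : ∀ i → fromℤ i ²ℚ ≡ fromℕ (ℤ.∣ i ∣ ℕ.^ 2)
fromℤ-sq i = trans (sym (fromℤ-* i i)) (trans (cong fromℤ (sq-abs i))
  (trans (fromℤ-* (ℤ.+ ℤ.∣ i ∣) (ℤ.+ ℤ.∣ i ∣)) (sym (fromℕ-sq ℤ.∣ i ∣))))
  where
  sq-abs : ∀ i → i ℤ.* i ≡ ℤ.+ ℤ.∣ i ∣ ℤ.* ℤ.+ ℤ.∣ i ∣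
  sq-abs (ℤ.+ n)    = refl
  sq-abs ℤ.-[1+ n ] = refl

IntegerMultiple : ℕ → ℚ → Set
IntegerMultiple N q = ∃[ i ] fromℕ N * q ≡ fromℤ i

scale-multiple : ∀ M N {q} → IntegerMultiple N q → IntegerMultiple (M ℕ.* N) q
scale-multiple M N {q} (i , Nq≡i) = ℤ.+ M ℤ.* i , (begin
  fromℕ (M ℕ.* N) * q
    ≡⟨ cong (_* q) (trans (cong fromℤ (ℤ.pos-* M N)) (fromℤ-* (ℤ.+ M) (ℤ.+ N))) ⟩
  fromℕ M * fromℕ N * q
    ≡⟨ ℚ.*-assoc (fromℕ M) (fromℕ N) q ⟩
  fromℕ M * (fromℕ N * q)
    ≡⟨ cong (fromℕ M *_) Nq≡i ⟩
  fromℕ M * fromℤ i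
    ≡⟨ sym (fromℤ-* (ℤ.+ M) i) ⟩
  fromℤ (ℤ.+ M ℤ.* i) ∎)
  where open ≡-Reasoning

commonDenominator : ∀ qs → ∃[ N ] 0 ℕ.< N × All (IntegerMultiple N) qs
commonDenominator []       = 1 , ℕ.z<s , []
commonDenominator (q ∷ qs) =
  let N , 0<N , ms = commonDenominator qs
      Nd≡dN = ℕ.*-comm N (↧ₙ q)
  in ↧ₙ q ℕ.* N
   , ℕ.*-mono-< {0} {↧ₙ q} {0} {N} (ℕ.z<s {ℚ.denominator-1 q}) 0<N
   -- `scale-multiple` puts the new factor on the left, so for `q` itself the product of
   -- denominators comes out in the opposite order.
   , subst (λ n → IntegerMultiple n q) Nd≡dN
       (scale-multiple N (↧ₙ q) {q} (↥ q , denominator*p q))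
   ∷ All.map (λ {q′} → scale-multiple (↧ₙ q) N {q′}) ms

-- The multiple N q is replaced by its absolute value, as only squares matter.
naturalRoot : ∀ {N q} → 0 ℕ.< N → q ≢ 0ℚ → IntegerMultiple N q →
  ∃[ k ] 0 ℕ.< k × fromℕ (k ℕ.^ 2) ≡ fromℕ N ²ℚ * q ²ℚ
naturalRoot {N} {q} 0<N q≢0 (i , Nq≡i) =
    ℤ.∣ i ∣
  , ℕ.n≢0⇒n>0 (λ ∣i∣≡0 → *-nonZero (>⇒≢0 (fromℤ>0 0<N)) q≢0
      (trans Nq≡i (trans (cong fromℤ (ℤ.∣i∣≡0⇒i≡0 ∣i∣≡0)) fromℤ-0)))
  , (begin
      fromℕ (ℤ.∣ i ∣ ℕ.^ 2)       ≡⟨ sym (fromℤ-sq i) ⟩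
      fromℤ i ²ℚ                  ≡⟨ cong _²ℚ (sym Nq≡i) ⟩
      (fromℕ N * q) ²ℚ            ≡⟨ sq-* (fromℕ N) q ⟩
      fromℕ N ²ℚ * q ²ℚ           ∎)
  where
  open ≡-Reasoning
  sq-* : ∀ x y → (x * y) ²ℚ ≡ x ²ℚ * y ²ℚ
  sq-* = solve 2 (λ x y → (x :* y) :* (x :* y) := (x :* x) :* (y :* y)) refl

natural-pythagoras : ∀ {k x y z} l m n →
  fromℕ (l ℕ.^ 2) ≡ k * x ²ℚ → fromℕ (m ℕ.^ 2) ≡ k * y ²ℚ → fromℕ (n ℕ.^ 2) ≡ k * z ²ℚ →
  x ²ℚ + y ²ℚ ≡ z ²ℚ → l ℕ.^ 2 ℕ.+ m ℕ.^ 2 ≡ n ℕ.^ 2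
natural-pythagoras {k} {x} {y} {z} l m n l² m² n² x²+y²≡z² = ℤ.+-injective (fromℤ-injective (begin
  fromℕ (l ℕ.^ 2 ℕ.+ m ℕ.^ 2)               ≡⟨ cong fromℤ (ℤ.pos-+ (l ℕ.^ 2) (m ℕ.^ 2)) ⟩
  fromℤ (ℤ.+ (l ℕ.^ 2) ℤ.+ ℤ.+ (m ℕ.^ 2))   ≡⟨ fromℤ-+ (ℤ.+ (l ℕ.^ 2)) (ℤ.+ (m ℕ.^ 2)) ⟩
  fromℕ (l ℕ.^ 2) + fromℕ (m ℕ.^ 2)         ≡⟨ cong₂ _+_ l² m² ⟩
  k * x ²ℚ + k * y ²ℚ                       ≡⟨ sym (ℚ.*-distribˡ-+ k (x ²ℚ) (y ²ℚ)) ⟩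
  k * (x ²ℚ + y ²ℚ)                         ≡⟨ cong (k *_) x²+y²≡z² ⟩
  k * z ²ℚ                                  ≡⟨ sym n² ⟩
  fromℕ (n ℕ.^ 2)                           ∎))
  where open ≡-Reasoning

-- The first two right triangles combine to the space relation; subtracting `x²` or `y²` from it and
-- comparing with the last two leaves the remaining face relations.
natural⇒cuboid : ∀ {x y w α β γ d} →
  0 ℕ.< x → 0 ℕ.< y → 0 ℕ.< w → 0 ℕ.< α → 0 ℕ.< β → 0 ℕ.< γ → 0 ℕ.< d →
  x ℕ.^ 2 ℕ.+ y ℕ.^ 2 ≡ γ ℕ.^ 2 → γ ℕ.^ 2 ℕ.+ w ℕ.^ 2 ≡ d ℕ.^ 2 →
  x ℕ.^ 2 ℕ.+ α ℕ.^ 2 ≡ d ℕ.^ 2 → y ℕ.^ 2 ℕ.+ β ℕ.^ 2 ≡ d ℕ.^ 2 →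
  PerfectEulerCuboid
natural⇒cuboid {x} {y} {w} {α} {β} {γ} {d} x>0 y>0 w>0 α>0 β>0 γ>0 d>0 xyγ γwd xαd yβd = record
  { a = x ; b = y ; c = w ; α = α ; β = β ; γ = γ ; d = d
  ; a>0 = x>0 ; b>0 = y>0 ; c>0 = w>0 ; α>0 = α>0 ; β>0 = β>0 ; γ>0 = γ>0 ; d>0 = d>0
  ; face-γ = xyγ
  ; face-α = ℕ.+-cancelˡ-≡ (x ℕ.^ 2) (y ℕ.^ 2 ℕ.+ w ℕ.^ 2) (α ℕ.^ 2)
      (trans (sym (ℕ.+-assoc (x ℕ.^ 2) (y ℕ.^ 2) (w ℕ.^ 2))) (trans xywd (sym xαd)))
  ; face-β = ℕ.+-cancelˡ-≡ (y ℕ.^ 2) (w ℕ.^ 2 ℕ.+ x ℕ.^ 2) (β ℕ.^ 2) (begin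
      y ℕ.^ 2 ℕ.+ (w ℕ.^ 2 ℕ.+ x ℕ.^ 2) ≡⟨ ℕ.+-comm (y ℕ.^ 2) (w ℕ.^ 2 ℕ.+ x ℕ.^ 2) ⟩
      w ℕ.^ 2 ℕ.+ x ℕ.^ 2 ℕ.+ y ℕ.^ 2   ≡⟨ ℕ.+-assoc (w ℕ.^ 2) (x ℕ.^ 2) (y ℕ.^ 2) ⟩
      w ℕ.^ 2 ℕ.+ (x ℕ.^ 2 ℕ.+ y ℕ.^ 2) ≡⟨ ℕ.+-comm (w ℕ.^ 2) (x ℕ.^ 2 ℕ.+ y ℕ.^ 2) ⟩
      x ℕ.^ 2 ℕ.+ y ℕ.^ 2 ℕ.+ w ℕ.^ 2   ≡⟨ xywd ⟩
      d ℕ.^ 2                           ≡⟨ sym yβd ⟩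
      y ℕ.^ 2 ℕ.+ β ℕ.^ 2               ∎)
  ; space  = xywd
  }
  where
  open ≡-Reasoning
  xywd : x ℕ.^ 2 ℕ.+ y ℕ.^ 2 ℕ.+ w ℕ.^ 2 ≡ d ℕ.^ 2
  xywd = trans (cong (ℕ._+ w ℕ.^ 2) xyγ) γwd

-- All seven lengths are scaled by the same `N`, so each relation is multiplied by `N²`. Non-zero
-- lengths suffice because `naturalRoot` absorbs signs.
rational⇒cuboid : ∀ {x y w α β γ d} →
  x ≢ 0ℚ → y ≢ 0ℚ → w ≢ 0ℚ → α ≢ 0ℚ → β ≢ 0ℚ → γ ≢ 0ℚ → d ≢ 0ℚ →
  x ²ℚ + y ²ℚ ≡ γ ²ℚ → γ ²ℚ + w ²ℚ ≡ d ²ℚ → x ²ℚ + α ²ℚ ≡ d ²ℚ → y ²ℚ + β ²ℚ ≡ d ²ℚ →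
  PerfectEulerCuboid
rational⇒cuboid {x} {y} {w} {α} {β} {γ} {d} x≢0 y≢0 w≢0 α≢0 β≢0 γ≢0 d≢0 xyγ γwd xαd yβd =
  build (commonDenominator (x ∷ y ∷ w ∷ α ∷ β ∷ γ ∷ d ∷ []))
  where
  build : ∃[ N ] 0 ℕ.< N × All (IntegerMultiple N) (x ∷ y ∷ w ∷ α ∷ β ∷ γ ∷ d ∷ []) →
          PerfectEulerCuboid
  build (N , 0<N , mx ∷ my ∷ mw ∷ mα ∷ mβ ∷ mγ ∷ md ∷ []) =
    let X , X>0 , X² = naturalRoot {N} {x} 0<N x≢0 mx
        Y , Y>0 , Y² = naturalRoot {N} {y} 0<N y≢0 my
        W , W>0 , W² = naturalRoot {N} {w} 0<N w≢0 mw
        A , A>0 , A² = naturalRoot {N} {α} 0<N α≢0 mα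
        B , B>0 , B² = naturalRoot {N} {β} 0<N β≢0 mβ
        G , G>0 , G² = naturalRoot {N} {γ} 0<N γ≢0 mγ
        D , D>0 , D² = naturalRoot {N} {d} 0<N d≢0 md
        k = fromℕ N ²ℚ
    in natural⇒cuboid {X} {Y} {W} {A} {B} {G} {D} X>0 Y>0 W>0 A>0 B>0 G>0 D>0
         (natural-pythagoras {k} {x} {y} {γ} X Y G X² Y² G² xyγ)
         (natural-pythagoras {k} {γ} {w} {d} G W D G² W² D² γwd)
         (natural-pythagoras {k} {x} {α} {d} X A D X² A² D² xαd)
         (natural-pythagoras {k} {y} {β} {d} Y B D Y² B² D² yβd)

-- Half-angle parametrisation

-- For an angle θ with cosine `l/h` and sine `m/h`, `t` is tan(θ/2): the equations are cos θ = (1 -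
-- t²)/(1 + t²) and sin θ = 2t/(1 + t²) with denominators cleared.
HalfAngle : ℚ → ℚ → ℚ → Set
HalfAngle l m h = ∃[ t ] (0ℚ ℚ.< t × t ℚ.< 1ℚ) ×
  ((1ℚ - t ²ℚ) * h ≡ (1ℚ + t ²ℚ) * l × (2ℚ * t) * h ≡ (1ℚ + t ²ℚ) * m)

halfAngle : ∀ {l m h} → 0ℚ ℚ.< l → 0ℚ ℚ.< m → 0ℚ ℚ.< h → l ²ℚ + m ²ℚ ≡ h ²ℚ → HalfAngle l m h
halfAngle {l} {m} {h} 0<l 0<m 0<h l²+m²≡h² =
  t , (0<t , 0<q-p⇒p<q 0<1-t) , (cosine , sine)
  where
  0<h+l : 0ℚ ℚ.< h + l
  0<h+l = 0<+ 0<h 0<l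
  -- This is tan(θ/2) = sin θ / (1 + cos θ), expanded by `h`.
  t : ℚ
  t = m * recip (h + l)
  t[h+l]≡m : t * (h + l) ≡ m
  t[h+l]≡m =
    let _ , inverse = recip-spec (h + l) 0<h+l in
    trans (ℚ.*-assoc m (recip (h + l)) (h + l))
      (trans (cong (m *_) (trans (ℚ.*-comm (recip (h + l)) (h + l)) inverse)) (ℚ.*-identityʳ m))
  0<t : 0ℚ ℚ.< t
  0<t = *-cancelʳ-0<-pos 0<h+l (subst (0ℚ ℚ.<_) (sym t[h+l]≡m) 0<m)
  -- After multiplication by `h + l` the two sides differ by `h² - l² - (t(h + l))²`, which vanishes
  -- since `t(h + l) = m`.
  cosine : (1ℚ - t ²ℚ) * h ≡ (1ℚ + t ²ℚ) * l
  cosine = *-cancelˡ-pos 0<h+l (balance (identity t h l)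
    (trans (cong (λ x → l ²ℚ + x ²ℚ) t[h+l]≡m) l²+m²≡h²))
    where
    identity : ∀ t h l → (h + l) * ((1ℚ - t ²ℚ) * h) + (l ²ℚ + (t * (h + l)) ²ℚ)
                       ≡ (h + l) * ((1ℚ + t ²ℚ) * l) + h ²ℚ
    identity = solve 3 (λ t h l →
      (h :+ l) :* ((con 1ℚ :- t :* t) :* h) :+ (l :* l :+ (t :* (h :+ l)) :* (t :* (h :+ l)))
      := (h :+ l) :* ((con 1ℚ :+ t :* t) :* l) :+ h :* h) refl
  sine : (2ℚ * t) * h ≡ (1ℚ + t ²ℚ) * m
  sine = trans (balance (identity t h l) (cong (t *_) (sym cosine)))
    (cong ((1ℚ + t ²ℚ) *_) t[h+l]≡m)
    where
    identity : ∀ t h l → (2ℚ * t) * h + t * ((1ℚ + t ²ℚ) * l)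
                       ≡ (1ℚ + t ²ℚ) * (t * (h + l)) + t * ((1ℚ - t ²ℚ) * h)
    identity = solve 3 (λ t h l →
      (con 2ℚ :* t) :* h :+ t :* ((con 1ℚ :+ t :* t) :* l)
      := (con 1ℚ :+ t :* t) :* (t :* (h :+ l)) :+ t :* ((con 1ℚ :- t :* t) :* h)) refl
  -- The product of `1 - t` with the positive `(1 + t)h` is `(1 + t²)l`, which is positive.
  0<1-t : 0ℚ ℚ.< 1ℚ - t
  0<1-t = *-cancelʳ-0<-pos (pos* (0<+ 0<1 0<t) 0<h)
    (subst (0ℚ ℚ.<_) (trans (sym cosine) (factor t h)) (pos* (0<1+sq t) 0<l))
    where
    factor : ∀ t h → (1ℚ - t ²ℚ) * h ≡ (1ℚ - t) * ((1ℚ + t) * h)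
    factor = solve 2 (λ t h →
      (con 1ℚ :- t :* t) :* h := (con 1ℚ :- t) :* ((con 1ℚ :+ t) :* h)) refl

-- Polynomial identities in the half-angle tangents

pythagoras : ∀ t k → ((1ℚ - t ²ℚ) * k) ²ℚ + (2ℚ * t * k) ²ℚ ≡ ((1ℚ + t ²ℚ) * k) ²ℚ
pythagoras = solve 2 (λ t k → let sq = λ x → x :* x in
  sq ((con 1ℚ :- sq t) :* k) :+ sq (con 2ℚ :* t :* k) := sq ((con 1ℚ :+ sq t) :* k)) refl

-- With (x , y , γ) = ((1 - a²)/(1 + a²) , (1 - b²)/(1 + b²) , (1 - u²)/(1 + u²)),
-- P is x² + y² - γ² cleared of denominators.
P-factorisation : ∀ a b u → let p = a ²ℚ; q = b ²ℚ; r = u ²ℚ in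
  P a b u ≡ ((1ℚ - p) * ((1ℚ + q) * (1ℚ + r))) ²ℚ + ((1ℚ - q) * ((1ℚ + p) * (1ℚ + r))) ²ℚ
          - ((1ℚ - r) * ((1ℚ + p) * (1ℚ + q))) ²ℚ
P-factorisation = solve 3 (λ a b u →
  let p = a :* a ; q = b :* b ; r = u :* u ; 1′ = con 1ℚ; sq = λ x → x :* x in
      u :^ 4 :* a :^ 4 :* b :^ 4 :+ con 6ℚ :* a :^ 4 :* u :^ 2 :* b :^ 4
    :- con 2ℚ :* u :^ 4 :* a :^ 4 :* b :^ 2 :- con 2ℚ :* u :^ 4 :* a :^ 2 :* b :^ 4
    :+ con 4ℚ :* u :^ 2 :* b :^ 4 :* a :^ 2 :+ con 4ℚ :* a :^ 4 :* u :^ 2 :* b :^ 2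
    :- con 12ℚ :* u :^ 4 :* a :^ 2 :* b :^ 2 :+ u :^ 4 :* a :^ 4 :+ u :^ 4 :* b :^ 4
    :+ a :^ 4 :* b :^ 4 :+ con 6ℚ :* a :^ 4 :* u :^ 2 :+ con 6ℚ :* u :^ 2 :* b :^ 4
    :- con 8ℚ :* a :^ 2 :* b :^ 2 :* u :^ 2 :- con 2ℚ :* u :^ 4 :* a :^ 2
    :- con 2ℚ :* u :^ 4 :* b :^ 2 :- con 2ℚ :* a :^ 4 :* b :^ 2
    :- con 2ℚ :* b :^ 4 :* a :^ 2 :+ u :^ 4 :+ b :^ 4 :+ a :^ 4
    :+ con 4ℚ :* a :^ 2 :* u :^ 2 :+ con 4ℚ :* b :^ 2 :* u :^ 2
    :- con 12ℚ :* b :^ 2 :* a :^ 2 :+ con 6ℚ :* u :^ 2 :- con 2ℚ :* a :^ 2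
    :- con 2ℚ :* b :^ 2 :+ con 1ℚ
  := sq ((1′ :- p) :* ((1′ :+ q) :* (1′ :+ r))) :+ sq ((1′ :- q) :* ((1′ :+ p) :* (1′ :+ r)))
     :- sq ((1′ :- r) :* ((1′ :+ p) :* (1′ :+ q)))) refl

module _ (p q r : ℚ) where

  private
    -- The common denominator of the three cosines; it becomes the space diagonal of the cuboid
    -- built from a root of `P`.
    K : ℚ
    K = (1ℚ + r) * ((1ℚ + p) * (1ℚ + q))

  denominator-p : (1ℚ + p) * ((1ℚ + q) * (1ℚ + r)) ≡ K
  denominator-p = solve 3 (λ p q r →
    (con 1ℚ :+ p) :* ((con 1ℚ :+ q) :* (con 1ℚ :+ r))
    := (con 1ℚ :+ r) :* ((con 1ℚ :+ p) :* (con 1ℚ :+ q))) refl p q r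

  denominator-q : (1ℚ + q) * ((1ℚ + p) * (1ℚ + r)) ≡ K
  denominator-q = solve 3 (λ p q r →
    (con 1ℚ :+ q) :* ((con 1ℚ :+ p) :* (con 1ℚ :+ r))
    := (con 1ℚ :+ r) :* ((con 1ℚ :+ p) :* (con 1ℚ :+ q))) refl p q r

  -- Multiplied by `d`, the three bases become `K * x`, `K * y` and `K * γ`, so `d²` times the claim
  -- is `K²` times the face relation. With `P-factorisation` this makes `P` vanish.
  scaled-squares : ∀ {d x y γ} → 0ℚ ℚ.< d →
    (1ℚ - p) * d ≡ (1ℚ + p) * x → (1ℚ - q) * d ≡ (1ℚ + q) * y → (1ℚ - r) * d ≡ (1ℚ + r) * γ →
    x ²ℚ + y ²ℚ ≡ γ ²ℚ →
    ((1ℚ - p) * ((1ℚ + q) * (1ℚ + r))) ²ℚ + ((1ℚ - q) * ((1ℚ + p) * (1ℚ + r))) ²ℚ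
      ≡ ((1ℚ - r) * ((1ℚ + p) * (1ℚ + q))) ²ℚ
  scaled-squares {d} {x} {y} {γ} 0<d ex ey eγ x²+y²≡γ² = *-cancelˡ-pos (pos* 0<d 0<d) (begin
    d ²ℚ * (((1ℚ - p) * ((1ℚ + q) * (1ℚ + r))) ²ℚ + ((1ℚ - q) * ((1ℚ + p) * (1ℚ + r))) ²ℚ)
      ≡⟨ split d ((1ℚ - p) * ((1ℚ + q) * (1ℚ + r))) ((1ℚ - q) * ((1ℚ + p) * (1ℚ + r))) ⟩
    (d * ((1ℚ - p) * ((1ℚ + q) * (1ℚ + r)))) ²ℚ + (d * ((1ℚ - q) * ((1ℚ + p) * (1ℚ + r)))) ²ℚ
      ≡⟨ cong₂ (λ s t → s ²ℚ + t ²ℚ)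
           (trans (scale d (1ℚ - p) (1ℚ + p) _ ex) (cong (_* x) denominator-p))
           (trans (scale d (1ℚ - q) (1ℚ + q) _ ey) (cong (_* y) denominator-q)) ⟩
    (K * x) ²ℚ + (K * y) ²ℚ
      ≡⟨ sym (split K x y) ⟩
    K ²ℚ * (x ²ℚ + y ²ℚ)
      ≡⟨ cong (K ²ℚ *_) x²+y²≡γ² ⟩
    K ²ℚ * γ ²ℚ
      ≡⟨ sq-* K γ ⟩
    (K * γ) ²ℚ
      ≡⟨ cong _²ℚ (sym (scale d (1ℚ - r) (1ℚ + r) _ eγ)) ⟩
    (d * ((1ℚ - r) * ((1ℚ + p) * (1ℚ + q)))) ²ℚ
      ≡⟨ sym (sq-* d _) ⟩
    d ²ℚ * ((1ℚ - r) * ((1ℚ + p) * (1ℚ + q))) ²ℚ ∎)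
    where
    open ≡-Reasoning
    sq-* : ∀ k s → k ²ℚ * s ²ℚ ≡ (k * s) ²ℚ
    sq-* = solve 2 (λ k s → (k :* k) :* (s :* s) := (k :* s) :* (k :* s)) refl
    split : ∀ k s t → k ²ℚ * (s ²ℚ + t ²ℚ) ≡ (k * s) ²ℚ + (k * t) ²ℚ
    split = solve 3 (λ k s t → (k :* k) :* (s :* s :+ t :* t)
      := (k :* s) :* (k :* s) :+ (k :* t) :* (k :* t)) refl
    scale : ∀ d s t m {v} → s * d ≡ t * v → d * (s * m) ≡ (t * m) * v
    scale d s t m {v} sd≡tv = trans
      (solve 3 (λ d s m → d :* (s :* m) := (s :* d) :* m) refl d s m)
      (trans (cong (_* m) sd≡tv)
        (solve 3 (λ t v m → (t :* v) :* m := (t :* m) :* v) refl t v m))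

-- If cos θ = l / d = (γ / d) (v / w) and γ / d = (1 - r)/(1 + r), then the
-- tangent-square p of θ/2 satisfies (1 - p)/(1 + p) = (1 - r) v / ((1 + r) w).
compose-cosines : ∀ {p r d l γ v w} → 0ℚ ℚ.< d →
  (1ℚ - p) * d ≡ (1ℚ + p) * l → (1ℚ - r) * d ≡ (1ℚ + r) * γ → v * γ ≡ w * l →
  (1ℚ - p) * ((1ℚ + r) * w) ≡ (1ℚ + p) * ((1ℚ - r) * v)
compose-cosines {p} {r} {d} {l} {γ} {v} {w} 0<d el eγ evw = *-cancelˡ-pos 0<d (begin
  d * ((1ℚ - p) * ((1ℚ + r) * w))
    ≡⟨ solve 4 (λ d p r w → d :* ((con 1ℚ :- p) :* ((con 1ℚ :+ r) :* w))
         := ((con 1ℚ :- p) :* d) :* ((con 1ℚ :+ r) :* w)) refl d p r w ⟩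
  ((1ℚ - p) * d) * ((1ℚ + r) * w)
    ≡⟨ cong (_* ((1ℚ + r) * w)) el ⟩
  ((1ℚ + p) * l) * ((1ℚ + r) * w)
    ≡⟨ solve 4 (λ p l r w → ((con 1ℚ :+ p) :* l) :* ((con 1ℚ :+ r) :* w)
         := (con 1ℚ :+ p) :* ((con 1ℚ :+ r) :* (w :* l))) refl p l r w ⟩
  (1ℚ + p) * ((1ℚ + r) * (w * l))
    ≡⟨ cong (λ e → (1ℚ + p) * ((1ℚ + r) * e)) (sym evw) ⟩
  (1ℚ + p) * ((1ℚ + r) * (v * γ))
    ≡⟨ solve 4 (λ p r v γ → (con 1ℚ :+ p) :* ((con 1ℚ :+ r) :* (v :* γ))
         := ((con 1ℚ :+ r) :* γ) :* ((con 1ℚ :+ p) :* v)) refl p r v γ ⟩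
  ((1ℚ + r) * γ) * ((1ℚ + p) * v)
    ≡⟨ cong (_* ((1ℚ + p) * v)) (sym eγ) ⟩
  ((1ℚ - r) * d) * ((1ℚ + p) * v)
    ≡⟨ solve 4 (λ r d p v → ((con 1ℚ :- r) :* d) :* ((con 1ℚ :+ p) :* v)
         := d :* ((con 1ℚ :+ p) :* ((con 1ℚ :- r) :* v))) refl r d p v ⟩
  d * ((1ℚ + p) * ((1ℚ - r) * v)) ∎)
  where open ≡-Reasoning

-- The hypothesis equates a cosine with a product of two cosines. With `r = u²`, `s = z²`, solving
-- it for `p` gives a quotient of the difference and the sum of `(1 + r)(1 + s)` and
-- `(1 - r)(1 - s)`, which are `2(r + s)` and `2(1 + rs)`.
a²-identity : ∀ p u z →
  (1ℚ - p) * ((1ℚ + u ²ℚ) * (1ℚ + z ²ℚ)) ≡ (1ℚ + p) * ((1ℚ - u ²ℚ) * (1ℚ - z ²ℚ)) →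
  p * (u ²ℚ * z ²ℚ + 1ℚ) ≡ u ²ℚ + z ²ℚ
a²-identity p u z e = *-cancelˡ-pos (ℚ.positive⁻¹ 2ℚ) (balance
  (solve 3 (λ p u z → let r = u :* u; s = z :* z; 1′ = con 1ℚ in
    con 2ℚ :* (p :* (r :* s :+ 1′)) :+ (1′ :- p) :* ((1′ :+ r) :* (1′ :+ s))
    := con 2ℚ :* (r :+ s) :+ (1′ :+ p) :* ((1′ :- r) :* (1′ :- s))) refl p u z)
  e)

-- The same linear equation, with the sine `2z/(1 + z²)` in place of the second cosine.
b²-identity : ∀ q u z →
  (1ℚ - q) * ((1ℚ + u ²ℚ) * (1ℚ + z ²ℚ)) ≡ (1ℚ + q) * ((1ℚ - u ²ℚ) * (2ℚ * z)) →
  q * ((1ℚ + u ²ℚ) * (1ℚ + z ²ℚ) + 2ℚ * z * (1ℚ - u ²ℚ))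
    ≡ (1ℚ + u ²ℚ) * (1ℚ + z ²ℚ) - 2ℚ * z * (1ℚ - u ²ℚ)
b²-identity q u z e = balance
  (solve 3 (λ q u z → let 1′ = con 1ℚ
                          s = (1′ :+ u :* u) :* (1′ :+ z :* z)
                          t = con 2ℚ :* z :* (1′ :- u :* u) in
    q :* (s :+ t) :+ (1′ :- q) :* s
    := (s :- t) :+ (1′ :+ q) :* ((1′ :- u :* u) :* (con 2ℚ :* z))) refl q u z)
  e

-- Real numbers

fromℚ-mono-< : ∀ {p q} → p ℚ.< q → fromℚ p < fromℚ q
fromℚ-mono-< p<q =
  -- The order on `ℝ` demands an `ε` strictly below the gap, so `q - p` itself will not do.
  let ε , 0<ε , ε<q-p = ℚ.<-dense (p<q⇒0<q-p p<q) in ε , 0<ε , 0 , λ _ _ → ε<q-p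

fromℚ-cancel-< : ∀ {p q} → fromℚ p < fromℚ q → p ℚ.< q
fromℚ-cancel-< (ε , 0<ε , N , h) = 0<q-p⇒p<q (ℚ.<-trans 0<ε (h N ℕ.≤-refl))

-- Once the terms of `y` are positive, `recip` is a true inverse and the two sequences agree term by
-- term; one index therefore serves every `ε`.
*≗⇒≈/ : ∀ w x y (0<y : 0ℝ < y) → (∀ n → seq w n * seq y n ≡ seq x n) → w ≈ x / y ⟨ 0<y ⟩
*≗⇒≈/ w x y (e , 0<e , N , h) wy≡x ε 0<ε = N , λ n N≤n →
  let 0<yₙ = subst (0ℚ ℚ.<_) (ℚ.+-identityʳ (seq y n)) (ℚ.<-trans 0<e (h n N≤n))
      _ , inverse = recip-spec (seq y n) 0<yₙ
      w≡x/y = trans (sym (ℚ.*-identityʳ (seq w n)))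
        (trans (cong (seq w n *_) (sym inverse))
          (trans (sym (ℚ.*-assoc (seq w n) (seq y n) (recip (seq y n))))
            (cong (_* recip (seq y n)) (wy≡x n))))
  in subst (λ v → ℚ.∣ seq w n - v ∣ ℚ.< ε) w≡x/y
       (subst (λ v → ℚ.∣ v ∣ ℚ.< ε) (sym (ℚ.+-inverseʳ (seq w n))) 0<ε)

-- If `x/y` were 1, then `y - x = y(1 - x/y)` would tend to 0 because `y` is bounded, yet it
-- eventually exceeds a fixed `ε`. The choice `Bδ = ε` makes the two bounds collide at a single
-- index.
<⇒1≉/ : ∀ {x y} (0<y : 0ℝ < y) → x < y → ¬ (1ℝ ≈ x / y ⟨ 0<y ⟩)
<⇒1≉/ {x} {y} (e , 0<e , K , hK) (ε , 0<ε , L , hL) 1≈x/y =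
  let B , 0<B , M , hM = bounded (seq y) (cauchy y)
      δ , 0<δ , Bδ≡ε = quotient B ε 0<B 0<ε
      N , hN = 1≈x/y δ 0<δ
      n = (K ℕ.⊔ L) ℕ.⊔ (M ℕ.⊔ N)
      KL≤n = ℕ.m≤m⊔n (K ℕ.⊔ L) (M ℕ.⊔ N)
      MN≤n = ℕ.m≤n⊔m (K ℕ.⊔ L) (M ℕ.⊔ N)
      yₙ = seq y n
      xₙ = seq x n
      0<yₙ = subst (0ℚ ℚ.<_) (ℚ.+-identityʳ yₙ)
        (ℚ.<-trans 0<e (hK n (ℕ.m⊔n≤o⇒m≤o K L KL≤n)))
      _ , inverse = recip-spec yₙ 0<yₙ
      y-x≡ : yₙ * (1ℚ - xₙ * recip yₙ) ≡ yₙ - xₙ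
      y-x≡ = trans
        (solve 3 (λ x y i → y :* (con 1ℚ :- x :* i) := y :- x :* (y :* i)) refl xₙ yₙ (recip yₙ))
        (trans (cong (λ v → yₙ - xₙ * v) inverse) (cong (λ v → yₙ - v) (ℚ.*-identityʳ xₙ)))
      ε<y-x = hL n (ℕ.m⊔n≤o⇒n≤o K L KL≤n)
      ∣y-x∣<ε = subst (λ v → ℚ.∣ v ∣ ℚ.< ε) y-x≡
        (∣*∣< yₙ (1ℚ - xₙ * recip yₙ) B δ ε 0<B Bδ≡ε
          (hM n (ℕ.m⊔n≤o⇒m≤o M N MN≤n)) (hN n (ℕ.m⊔n≤o⇒n≤o M N MN≤n)))
  in ℚ.<-irrefl refl (ℚ.<-trans ε<y-x
       (subst (ℚ._< ε) (ℚ.0≤p⇒∣p∣≡p (ℚ.<⇒≤ (ℚ.<-trans 0<ε ε<y-x))) ∣y-x∣<ε))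

-- The difference is `(1 - u)(1 - z)(1 + u)(1 + z)`, whose factors eventually exceed `e`, `f`, 1 and
-- 1.
a²-num<a²-den : ∀ {u z} → (u , z) ∈ D-uz → a²-num u z < a²-den u z
a²-num<a²-den {u} {z}
  (((e₀ , 0<e₀ , K , hK) , (e , 0<e , L , hL)) , ((f₀ , 0<f₀ , M , hM) , (f , 0<f , N , hN))) =
    (e * f) * (1ℚ * 1ℚ) , pos* (pos* 0<e 0<f) 0<1 , (K ℕ.⊔ L) ℕ.⊔ (M ℕ.⊔ N) , λ n ≤n →
    let KL≤n = ℕ.m⊔n≤o⇒m≤o (K ℕ.⊔ L) (M ℕ.⊔ N) ≤n
        MN≤n = ℕ.m⊔n≤o⇒n≤o (K ℕ.⊔ L) (M ℕ.⊔ N) ≤n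
    in subst ((e * f) * (1ℚ * 1ℚ) ℚ.<_) (identity (seq u n) (seq z n))
      (*-mono-<-pos (pos* 0<e 0<f)
        (*-mono-<-pos 0<e (hL n (ℕ.m⊔n≤o⇒n≤o K L KL≤n)) 0<f (hN n (ℕ.m⊔n≤o⇒n≤o M N MN≤n)))
        0<1
        (*-mono-<-pos 0<1 (1<1+ (ℚ.<-trans 0<e₀ (hK n (ℕ.m⊔n≤o⇒m≤o K L KL≤n))))
                      0<1 (1<1+ (ℚ.<-trans 0<f₀ (hM n (ℕ.m⊔n≤o⇒m≤o M N MN≤n))))))
  where
  -- The terms `u - 0ℚ` and `z - 0ℚ` are the shape in which `0ℝ < u` and `0ℝ < z` supply their
  -- bounds.
  identity : ∀ u z → ((1ℚ - u) * (1ℚ - z)) * ((1ℚ + (u - 0ℚ)) * (1ℚ + (z - 0ℚ)))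
                   ≡ u ²ℚ * z ²ℚ + 1ℚ - (u ²ℚ + z ²ℚ)
  identity = solve 2 (λ u z →
    ((con 1ℚ :- u) :* (con 1ℚ :- z))
      :* ((con 1ℚ :+ (u :- con 0ℚ)) :* (con 1ℚ :+ (z :- con 0ℚ)))
    := (u :* u) :* (z :* z) :+ con 1ℚ :- (u :* u :+ z :* z)) refl

-- The difference is `4z(1 - u)(1 + u)`; the factors `1 - u` and `z` are bounded below by `e` and
-- `f`, the factors `1 + u` and 4 by 1.
b²-num<b²-den : ∀ {u z} → (u , z) ∈ D-uz → b²-num u z < b²-den u z
b²-num<b²-den {u} {z} (((e₀ , 0<e₀ , K , hK) , (e , 0<e , L , hL)) , ((f , 0<f , M , hM) , _)) =
    (e * 1ℚ) * (f * 1ℚ) , pos* (pos* 0<e 0<1) (pos* 0<f 0<1) , (K ℕ.⊔ L) ℕ.⊔ M , λ n ≤n →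
    let KL≤n = ℕ.m⊔n≤o⇒m≤o (K ℕ.⊔ L) M ≤n
    in subst ((e * 1ℚ) * (f * 1ℚ) ℚ.<_) (identity (seq u n) (seq z n))
      (*-mono-<-pos (pos* 0<e 0<1)
        (*-mono-<-pos 0<e (hL n (ℕ.m⊔n≤o⇒n≤o K L KL≤n))
           0<1 (1<1+ (ℚ.<-trans 0<e₀ (hK n (ℕ.m⊔n≤o⇒m≤o K L KL≤n)))))
        (pos* 0<f 0<1)
        (*-mono-<-pos 0<f (hM n (ℕ.m⊔n≤o⇒n≤o (K ℕ.⊔ L) M ≤n))
           0<1 (0<q-p⇒p<q (ℚ.positive⁻¹ (4ℚ - 1ℚ)))))
  where
  identity : ∀ u z → ((1ℚ - u) * (1ℚ + (u - 0ℚ))) * ((z - 0ℚ) * 4ℚ)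
    ≡ (1ℚ + u ²ℚ) * (1ℚ + z ²ℚ) + 2ℚ * z * (1ℚ - u ²ℚ)
      - ((1ℚ + u ²ℚ) * (1ℚ + z ²ℚ) - 2ℚ * z * (1ℚ - u ²ℚ))
  identity = solve 2 (λ u z →
    let s = (con 1ℚ :+ u :* u) :* (con 1ℚ :+ z :* z)
        t = con 2ℚ :* z :* (con 1ℚ :- u :* u)
    in ((con 1ℚ :- u) :* (con 1ℚ :+ (u :- con 0ℚ))) :* ((z :- con 0ℚ) :* con 4ℚ)
       := s :+ t :- (s :- t)) refl

-- As `fromℚ a ²` is a constant sequence, `a² = 1` would make the quotient equal to 1, against
-- `<⇒1≉/`. This keeps the edges obtained from a root of `P` from vanishing.
≈/⇒1-sq≢0 : ∀ {a x y} (0<y : 0ℝ < y) → x < y → fromℚ a ² ≈ x / y ⟨ 0<y ⟩ → 1ℚ - a ²ℚ ≢ 0ℚ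
≈/⇒1-sq≢0 {a} {x} {y} 0<y x<y a²≈ 1-a²≡0 = <⇒1≉/ {x} {y} 0<y x<y λ ε 0<ε →
  let N , h = a²≈ ε 0<ε in
  N , λ n N≤n → subst (λ v → ℚ.∣ v - seq (x / y ⟨ 0<y ⟩) n ∣ ℚ.< ε)
    (sym (x∙y⁻¹≈ε⇒x≈y 1ℚ (a ²ℚ) 1-a²≡0)) (h n N≤n)

-- The two directions of the equivalence

Parameters : Set
Parameters = ∃[ a ] ∃[ b ] ∃[ u ]
  ((0ℚ ℚ.< u × u ℚ.< 1ℚ) × (fromℚ a , fromℚ b) ∈ D-ab × P a b u ≡ 0ℚ)

fromℕ-pythagoras : ∀ l m n → l ℕ.^ 2 ℕ.+ m ℕ.^ 2 ≡ n ℕ.^ 2 →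
  fromℕ l ²ℚ + fromℕ m ²ℚ ≡ fromℕ n ²ℚ
fromℕ-pythagoras l m n l²+m²≡n² = begin
  fromℕ l ²ℚ + fromℕ m ²ℚ            ≡⟨ sym (cong₂ _+_ (fromℕ-sq l) (fromℕ-sq m)) ⟩
  fromℕ (l ℕ.^ 2) + fromℕ (m ℕ.^ 2)  ≡⟨ sym (fromℤ-+ (ℤ.+ (l ℕ.^ 2)) (ℤ.+ (m ℕ.^ 2))) ⟩
  fromℕ (l ℕ.^ 2 ℕ.+ m ℕ.^ 2)        ≡⟨ cong fromℕ l²+m²≡n² ⟩
  fromℕ (n ℕ.^ 2)                    ≡⟨ fromℕ-sq n ⟩
  fromℕ n ²ℚ                         ∎
  where open ≡-Reasoning

-- The angles of `u`, `a`, `b` have cosines `γ/d`, `x/d`, `y/d`, and that of `z` has cosine `x/γ`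
-- and sine `y/γ`. The equations of `f` express `x/d = (γ/d)(x/γ)` and `y/d = (γ/d)(y/γ)`.
halfAngles⇒parameters : ∀ {x y w α β γ d} → 0ℚ ℚ.< d → x ²ℚ + y ²ℚ ≡ γ ²ℚ →
  HalfAngle γ w d → HalfAngle x y γ → HalfAngle x α d → HalfAngle y β d → Parameters
halfAngles⇒parameters {x} {y} {w} {α} {β} {γ} {d} 0<d x²+y²≡γ²
  (u , (0<u , u<1) , (cos-u , _)) (z , (0<z , z<1) , (cos-z , sin-z))
  (a , (0<a , _) , (cos-a , _)) (b , (0<b , _) , (cos-b , _)) =
    a , b , u , (0<u , u<1) , (fromℚ u , fromℚ z , uz∈D , record
      { a>0 = fromℚ-mono-< 0<a
      ; b>0 = fromℚ-mono-< 0<b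
      ; a²≈ = *≗⇒≈/ (fromℚ a ²) (a²-num (fromℚ u) (fromℚ z)) (a²-den (fromℚ u) (fromℚ z))
          (a²-den>0 (fromℚ u) (fromℚ z) uz∈D)
          λ _ → a²-identity p u z (compose-cosines {p} {r} {d} {x} {γ} 0<d cos-a cos-u cos-z)
      ; b²≈ = *≗⇒≈/ (fromℚ b ²) (b²-num (fromℚ u) (fromℚ z)) (b²-den (fromℚ u) (fromℚ z))
          (b²-den>0 (fromℚ u) (fromℚ z) uz∈D)
          λ _ → b²-identity q u z (compose-cosines {q} {r} {d} {y} {γ} 0<d cos-b cos-u sin-z)
      })
    , (begin
        P a b u
          ≡⟨ P-factorisation a b u ⟩
        X ²ℚ + Y ²ℚ - G ²ℚ
          ≡⟨ cong (_- G ²ℚ)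
               (scaled-squares p q r {d} {x} {y} {γ} 0<d cos-a cos-b cos-u x²+y²≡γ²) ⟩
        G ²ℚ - G ²ℚ
          ≡⟨ ℚ.+-inverseʳ (G ²ℚ) ⟩
        0ℚ ∎)
  where
  open ≡-Reasoning
  p q r X Y G : ℚ
  p = a ²ℚ
  q = b ²ℚ
  r = u ²ℚ
  X = (1ℚ - p) * ((1ℚ + q) * (1ℚ + r))
  Y = (1ℚ - q) * ((1ℚ + p) * (1ℚ + r))
  G = (1ℚ - r) * ((1ℚ + p) * (1ℚ + q))
  uz∈D : (fromℚ u , fromℚ z) ∈ D-uz
  uz∈D = (fromℚ-mono-< 0<u , fromℚ-mono-< u<1) , (fromℚ-mono-< 0<z , fromℚ-mono-< z<1)

cuboid⇒parameters : PerfectEulerCuboid → Parameters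
cuboid⇒parameters cuboid = halfAngles⇒parameters (fromℤ>0 d>0) (fromℕ-pythagoras a b γ face-γ)
  (halfAngle (fromℤ>0 γ>0) (fromℤ>0 c>0) (fromℤ>0 d>0) (fromℕ-pythagoras γ c d γcd))
  (halfAngle (fromℤ>0 a>0) (fromℤ>0 b>0) (fromℤ>0 γ>0) (fromℕ-pythagoras a b γ face-γ))
  (halfAngle (fromℤ>0 a>0) (fromℤ>0 α>0) (fromℤ>0 d>0) (fromℕ-pythagoras a α d aαd))
  (halfAngle (fromℤ>0 b>0) (fromℤ>0 β>0) (fromℤ>0 d>0) (fromℕ-pythagoras b β d bβd))
  where
  open PerfectEulerCuboid cuboid
  open ≡-Reasoning
  -- The space relation is regrouped into three right triangles with hypotenuse `d`, each formed by
  -- an edge and the diagonal of the face perpendicular to it.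
  γcd : γ ℕ.^ 2 ℕ.+ c ℕ.^ 2 ≡ d ℕ.^ 2
  γcd = trans (cong (ℕ._+ c ℕ.^ 2) (sym face-γ)) space
  aαd : a ℕ.^ 2 ℕ.+ α ℕ.^ 2 ≡ d ℕ.^ 2
  aαd = trans (cong (a ℕ.^ 2 ℕ.+_) (sym face-α))
    (trans (sym (ℕ.+-assoc (a ℕ.^ 2) (b ℕ.^ 2) (c ℕ.^ 2))) space)
  bβd : b ℕ.^ 2 ℕ.+ β ℕ.^ 2 ≡ d ℕ.^ 2
  bβd = begin
    b ℕ.^ 2 ℕ.+ β ℕ.^ 2               ≡⟨ cong (b ℕ.^ 2 ℕ.+_) (sym face-β) ⟩
    b ℕ.^ 2 ℕ.+ (c ℕ.^ 2 ℕ.+ a ℕ.^ 2) ≡⟨ sym (ℕ.+-assoc (b ℕ.^ 2) (c ℕ.^ 2) (a ℕ.^ 2)) ⟩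
    b ℕ.^ 2 ℕ.+ c ℕ.^ 2 ℕ.+ a ℕ.^ 2   ≡⟨ ℕ.+-comm (b ℕ.^ 2 ℕ.+ c ℕ.^ 2) (a ℕ.^ 2) ⟩
    a ℕ.^ 2 ℕ.+ (b ℕ.^ 2 ℕ.+ c ℕ.^ 2) ≡⟨ sym (ℕ.+-assoc (a ℕ.^ 2) (b ℕ.^ 2) (c ℕ.^ 2)) ⟩
    a ℕ.^ 2 ℕ.+ b ℕ.^ 2 ℕ.+ c ℕ.^ 2   ≡⟨ space ⟩
    d ℕ.^ 2                           ∎

-- The witness `(v , z)` of membership in `D-ab` is not assumed to satisfy `v ≈ fromℚ u`. It yields
-- `a² ≠ 1` and `b² ≠ 1`, and the value of `f` there comes with `a, b > 0`.
parameters⇒cuboid : Parameters → PerfectEulerCuboid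
parameters⇒cuboid (a , b , u , (0<u , u<1) , (v , z , vz∈D , value) , P≡0) = rational⇒cuboid
  -- These are the cosines of the angles of `a` and `b`, the sines of those of `u`, `a`, `b`, the
  -- cosine of that of `u`, and 1, all multiplied by the common denominator.
  {(1ℚ - p) * ((1ℚ + q) * (1ℚ + r))} {(1ℚ - q) * ((1ℚ + p) * (1ℚ + r))}
  {2ℚ * u * ((1ℚ + p) * (1ℚ + q))} {2ℚ * a * ((1ℚ + q) * (1ℚ + r))}
  {2ℚ * b * ((1ℚ + p) * (1ℚ + r))} {(1ℚ - r) * ((1ℚ + p) * (1ℚ + q))}
  {(1ℚ + r) * ((1ℚ + p) * (1ℚ + q))}
  (*-nonZero 1-p≢0 (*-nonZero 1+q≢0 1+r≢0))
  (*-nonZero 1-q≢0 (*-nonZero 1+p≢0 1+r≢0))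
  (*-nonZero (2*-nonZero 0<u) (*-nonZero 1+p≢0 1+q≢0))
  (*-nonZero (2*-nonZero (fromℚ-cancel-< {0ℚ} {a} a>0)) (*-nonZero 1+q≢0 1+r≢0))
  (*-nonZero (2*-nonZero (fromℚ-cancel-< {0ℚ} {b} b>0)) (*-nonZero 1+p≢0 1+r≢0))
  (*-nonZero 1-r≢0 (*-nonZero 1+p≢0 1+q≢0))
  (*-nonZero 1+r≢0 (*-nonZero 1+p≢0 1+q≢0))
  (x∙y⁻¹≈ε⇒x≈y _ _ (trans (sym (P-factorisation a b u)) P≡0))
  (pythagoras u ((1ℚ + p) * (1ℚ + q)))
  (trans (pythagoras a ((1ℚ + q) * (1ℚ + r))) (cong _²ℚ (denominator-p p q r)))
  (trans (pythagoras b ((1ℚ + p) * (1ℚ + r))) (cong _²ℚ (denominator-q p q r)))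
  where
  open HasValue-f value
  p q r : ℚ
  p = a ²ℚ
  q = b ²ℚ
  r = u ²ℚ
  1+p≢0 : 1ℚ + p ≢ 0ℚ
  1+p≢0 = >⇒≢0 (0<1+sq a)
  1+q≢0 : 1ℚ + q ≢ 0ℚ
  1+q≢0 = >⇒≢0 (0<1+sq b)
  1+r≢0 : 1ℚ + r ≢ 0ℚ
  1+r≢0 = >⇒≢0 (0<1+sq u)
  1-p≢0 : 1ℚ - p ≢ 0ℚ
  1-p≢0 = ≈/⇒1-sq≢0 {a} {a²-num v z} {a²-den v z} (a²-den>0 v z vz∈D)
    (a²-num<a²-den {v} {z} vz∈D) a²≈
  1-q≢0 : 1ℚ - q ≢ 0ℚ
  1-q≢0 = ≈/⇒1-sq≢0 {b} {b²-num v z} {b²-den v z} (b²-den>0 v z vz∈D)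
    (b²-num<b²-den {v} {z} vz∈D) b²≈
  1-r≢0 : 1ℚ - r ≢ 0ℚ
  1-r≢0 = subst (_≢ 0ℚ)
    (solve 1 (λ u → (con 1ℚ :- u) :* (con 1ℚ :+ u) := con 1ℚ :- u :* u) refl u)
    (*-nonZero (>⇒≢0 (p<q⇒0<q-p u<1)) (>⇒≢0 (0<+ 0<1 0<u)))
  2*-nonZero : ∀ {q} → 0ℚ ℚ.< q → 2ℚ * q ≢ 0ℚ
  2*-nonZero 0<q = *-nonZero (>⇒≢0 (ℚ.positive⁻¹ 2ℚ)) (>⇒≢0 0<q)

theorem5p2 : PerfectEulerCuboid ⇔
    (∃[ a ] ∃[ b ] ∃[ u ]
    ((0ℚ ℚ.< u × u ℚ.< 1ℚ) × (fromℚ a , fromℚ b) ∈ D-ab × P a b u ≡ 0ℚ))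
theorem5p2 = mk⇔ cuboid⇒parameters parameters⇒cuboid
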